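{- Let $D$ be a partial layer decomposition (PLD) of a DAG $G=(V,A)$. Let $X\in V$ be a boundary variable of $\mathrm{Vars}(D)$. If in $G$ some (proper) ancestor of $X$ is directly connected by an arrow to some (proper) descendant of $X$, then there exists at most one insertion $D'$ of $X$ into $D$ such that $D'$ is a sub-PLD of a layer decomposition of $G$.
   Context: All graphs are finite. A layer decomposition of a DAG $G=(V,A)$ is a list $((T^0,S^0),\dots,(T^k,S^k))$ of pairs of subsets of $V$ such that: (D1) $(T^0,\dots,T^k)$ is an ordered partition of $V$ (into nonempty blocks); (D2) $S^i\subseteq T^i$ for every $i\in\{0,\dots,k\}$; (D3) for every $i\in\{0,\dots,k-1\}$, no two variables $X\in T^0\cup\dots\cup T^{i-1}\cup(T^i\setminus S^i)$ and $Y\in T^{i+1}\cup\dots\cup T^k$ are connected by an arrow in $G$; (D4) for every $i\in\{1,\dots,k\}$, every child in $G$ of a variable in $S^i$ belongs to $(T^i\setminus S^i)\cup S^{i-1}$, and every child of a variable in $S^0$ belongs to $T^0\setminus S^0$; (D5) for every $i\in\{0,\dots,k-1\}$, every parent in $G$ of a variable in $S^i$ belongs to $T^{i+1}$, and no variable in $S^k$ has a parent. For $W\subseteq V$, $G[W]$ is the subgraph of $G$ induced on $W$. A partial layer decomposition (PLD) $D$ of $G$ is a layer decomposition of $G[W]$ for some $W\subseteq V$; then $\mathrm{Vars}(D)=W$. In particular, a layer decomposition of $G$ is a PLD with $\mathrm{Vars}(D)=V$. Let $D=((T_1^0,S_1^0),\dots,(T_1^k,S_1^k))$ and $D'=((T_2^0,S_2^0),\dots,(T_2^j,S_2^j))$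 be PLDs of $G$ with $\mathrm{Vars}(D')\subseteq\mathrm{Vars}(D)$. $D'$ is a sub-PLD of $D$ iff there is a non-negative integer $m$ such that for all $i\in\{0,\dots,j\}$: $T_2^i\subseteq T_1^{i+m}$, $S_2^i\subseteq S_1^{i+m}$ and $T_2^i\setminus S_2^i\subseteq T_1^{i+m}\setminus S_1^{i+m}$. For a PLD $D$ of $G$ and $X\in V\setminus\mathrm{Vars}(D)$, an insertion of $X$ into $D$ is a PLD $D'$ of $G$ with $\mathrm{Vars}(D')=\mathrm{Vars}(D)\cup\{X\}$ such that $D$ is a sub-PLD of $D'$. For $W\subseteq V$, a boundary variable of $W$ is a variable $X\in V\setminus W$ such that some parent or child of $X$ in $G$ belongs to $W$. A proper ancestor (descendant) of $X$ is a node $Y\ne X$ from which (to which) there is a directed path to (from) $X$. -}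

module Defs where

open import Data.Fin using (Fin; zero; suc; toℕ; fromℕ; inject₁; _<_)
open import Data.Fin.Subset using (Subset; Nonempty; _∈_; _⊆_; _∪_; _─_; ⁅_⁆)
open import Data.Fin.Subset.Properties using (_∈?_)
open import Data.Nat using (ℕ; suc; _+_)
open import Data.Product using (∃-syntax; _×_; _,_; proj₁; proj₂)
open import Data.Sum using (_⊎_; map)
open import Data.Vec using (Vec; lookup)
open import Function using (id; _∘_)
open import Level using (0ℓ)
open import Relation.Binary using (Rel; Decidable)
open import Relation.Binary.Construct.Closure.Transitive using (TransClosure; [_]; _∷_)
open import Relation.Binary.PropositionalEquality using (_≡_; _≢_)
open import Relation.Nullary using (¬_)
open import Relation.Nullary.Decidable using (_×-dec_)

-- The vertex set is a subset of an ambient Fin N, so that induced subgraphs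
-- are again DAGs over the same N.
record DAG (N : ℕ) : Set₁ where
  infix 4 _⇒_ _⇒?_
  field
    V       : Subset N
    _⇒_     : Rel (Fin N) 0ℓ
    _⇒?_    : Decidable _⇒_
    source  : ∀ {x y} → x ⇒ y → x ∈ V
    target  : ∀ {x y} → x ⇒ y → y ∈ V
    acyclic : ∀ {x} → ¬ TransClosure _⇒_ x x

  Connected : Rel (Fin N) 0ℓ
  Connected x y = x ⇒ y ⊎ y ⇒ x

  ProperAncestor : Rel (Fin N) 0ℓ
  ProperAncestor y x = y ≢ x × TransClosure _⇒_ y x

  ProperDescendant : Rel (Fin N) 0ℓ
  ProperDescendant y x = y ≢ x × TransClosure _⇒_ x y

  IsBoundary : Subset N → Fin N → Set
  IsBoundary W x = x ∈ V ─ W × ∃[ y ] (y ∈ W × Connected y x)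

induced : ∀ {N} → DAG N → Subset N → DAG N
induced G W = record
  { V       = W
  ; _⇒_     = λ x y → x ∈ W × y ∈ W × x ⇒ y
  ; _⇒?_    = λ x y → (x ∈? W) ×-dec ((y ∈? W) ×-dec (x ⇒? y))
  ; source  = proj₁
  ; target  = proj₁ ∘ proj₂
  ; acyclic = acyclic ∘ forget
  }
  where
  open DAG G
  forget : ∀ {x y} → TransClosure (λ x y → x ∈ W × y ∈ W × x ⇒ y) x y → TransClosure _⇒_ x y
  forget [ (_ , _ , x⇒y) ]       = [ x⇒y ]
  forget ((_ , _ , x⇒y) ∷ y⇒⁺z) = x⇒y ∷ forget y⇒⁺z

-- Lists ((T⁰ , S⁰) , … , (Tᵏ , Sᵏ)) of pairs of sets.
record Layers (N : ℕ) : Set where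
  constructor mkLayers
  field
    k     : ℕ
    pairs : Vec (Subset N × Subset N) (suc k)

  T S : Fin (suc k) → Subset N
  T i = proj₁ (lookup pairs i)
  S i = proj₂ (lookup pairs i)

-- An index i : Fin k stands for both of the consecutive layers
-- inject₁ i (number i) and suc i (number i + 1).
record IsLayerDecomposition {N : ℕ} (G : DAG N) (D : Layers N) : Set where
  open DAG G
  open Layers D
  field
    nonempty   : ∀ i → Nonempty (T i)
    T⊆V        : ∀ i → T i ⊆ V
    covers     : ∀ {x} → x ∈ V → ∃[ i ] x ∈ T i
    disjoint   : ∀ {i j x} → x ∈ T i → x ∈ T j → i ≡ j

    S⊆T        : ∀ i → S i ⊆ T i

    separated  : ∀ (i : Fin k) {x y} →
                 (∃[ j ] (j < inject₁ i × x ∈ T j)) ⊎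
                   x ∈ T (inject₁ i) ─ S (inject₁ i) →
                 ∃[ j ] (inject₁ i < j × y ∈ T j) →
                 ¬ Connected x y

    children   : ∀ (i : Fin k) {x y} → x ∈ S (suc i) → x ⇒ y →
                 y ∈ (T (suc i) ─ S (suc i)) ∪ S (inject₁ i)
    children-0 : ∀ {x y} → x ∈ S zero → x ⇒ y → y ∈ T zero ─ S zero

    parents    : ∀ (i : Fin k) {x y} → x ∈ S (inject₁ i) → y ⇒ x → y ∈ T (suc i)
    parents-k  : ∀ {x y} → x ∈ S (fromℕ k) → ¬ (y ⇒ x)

record LayerDecomposition {N : ℕ} (G : DAG N) : Set where
  field
    layers               : Layers N
    isLayerDecomposition : IsLayerDecomposition G layers

record PLD {N : ℕ} (G : DAG N) : Set where
  field
    Vars               : Subset N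
    Vars⊆V             : Vars ⊆ DAG.V G
    layerDecomposition : LayerDecomposition (induced G Vars)

  open LayerDecomposition layerDecomposition public
  open Layers layers public

toPLD : ∀ {N} {G : DAG N} → LayerDecomposition G → PLD G
toPLD {G = G} E = record
  { Vars               = DAG.V G
  ; Vars⊆V             = id
  ; layerDecomposition = record
    { layers               = LayerDecomposition.layers E
    ; isLayerDecomposition = record
      { nonempty   = nonempty
      ; T⊆V        = T⊆V
      ; covers     = covers
      ; disjoint   = disjoint
      ; S⊆T        = S⊆T
      ; separated  = λ i p q → separated i p q ∘ map (proj₂ ∘ proj₂) (proj₂ ∘ proj₂)
      ; children   = λ i p → children i p ∘ proj₂ ∘ proj₂
      ; children-0 = λ p → children-0 p ∘ proj₂ ∘ proj₂
      ; parents    = λ i p → parents i p ∘ proj₂ ∘ proj₂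
      ; parents-k  = λ p → parents-k p ∘ proj₂ ∘ proj₂
      }
    }
  }
  where open IsLayerDecomposition (LayerDecomposition.isLayerDecomposition E)

-- The layer i′ with toℕ i′ ≡ toℕ i + m is the one numbered i + m;
-- in particular it is required to exist.
IsSubPLD : ∀ {N} {G : DAG N} → PLD G → PLD G → Set
IsSubPLD D′ D =
  D′.Vars ⊆ D.Vars ×
  ∃[ m ] (∀ i → ∃[ i′ ] (toℕ i′ ≡ toℕ i + m ×
    D′.T i ⊆ D.T i′ ×
    D′.S i ⊆ D.S i′ ×
    D′.T i ─ D′.S i ⊆ D.T i′ ─ D.S i′))
  where
  module D′ = PLD D′
  module D = PLD D

IsInsertion : ∀ {N} {G : DAG N} → Fin N → PLD G → PLD G → Set
IsInsertion {G = G} x D D′ =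
  x ∈ DAG.V G ─ PLD.Vars D ×
  PLD.Vars D′ ≡ PLD.Vars D ∪ ⁅ x ⁆ ×
  IsSubPLD D D′

IsExtendable : ∀ {N} {G : DAG N} → PLD G → Set
IsExtendable {G = G} D = ∃[ E ] IsSubPLD D (toPLD {G = G} E)

{-# OPTIONS --safe #-}
module Submission where

-- A layer decomposition amounts to a rank function f and a set S such that
-- f u ≡ f v + [v ∈ S] for every arrow u ⇒ v (with f onto {0 , … , k}).
-- By acyclicity the arrow between the ancestor P and the descendant Q is
-- P ⇒ Q, so the rank drops by [Q ∈ S] from P to Q; along the path
-- P → … → X → … → Q it drops by at least [X ∈ S] + [Q ∈ S], hence X ∉ S.
-- The rank of X is then fixed by its neighbour in Vars D and is at least the
-- rank of that neighbour, so no layer is added below D and both insertions carry the same rank function.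
-- In lemma names R stands for T ∖ S.

open import Defs
open import Data.Bool using (Bool; true; false)
open import Data.Fin using (Fin; zero; suc; toℕ; fromℕ; inject₁)
open import Data.Fin.Properties using (toℕ-injective; toℕ-inject₁; toℕ-fromℕ; toℕ≤pred[n]; <-cmp)
open import Data.Fin.Relation.Unary.Top using (view; ‵fromℕ; ‵inject₁)
open import Data.Fin.Subset using (Subset; _∈_; _∉_; _⊆_; _─_; ⁅_⁆; inside; outside)
open import Data.Fin.Subset.Properties
  using (_∈?_; ⊆-antisym; p─q⊆p; x∈p∧x∉q⇒x∈p─q; x∈p∪q⁻; x∈⁅x⁆; x∈⁅y⁆⇒x≡y; q⊆p∪q)
open import Data.Nat using (ℕ; suc; _+_; _≤_; _<_)
open import Data.Nat.Properties
  using (≤-antisym; ≤-reflexive; ≤-trans; m≤n+m; +-assoc; m+n≡0⇒n≡0; +-identityʳ; 1+n≰n)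
open import Data.Product using (∃-syntax; _×_; _,_; proj₁; proj₂)
open import Data.Sum using (_⊎_; inj₁; inj₂)
open import Data.Vec using (_∷_; here; there)
open import Data.Vec.Relation.Binary.Pointwise.Extensional using (ext; Pointwise-≡⇒≡)
open import Function using (_∘_)
open import Relation.Binary.Construct.Closure.Transitive using (TransClosure; [_]; _∷_; _++_; _∷ʳ_)
open import Relation.Binary.Definitions using (tri<; tri≈; tri>)
open import Relation.Binary.PropositionalEquality
  using (_≡_; refl; sym; trans; cong; cong₂; subst)
open import Relation.Nullary using (¬_; yes; no; contradiction)

private variable
  N n m : ℕ
  b c : Bool
  x y : Fin N

x∈p─q⇒x∉q : ∀ (p q : Subset N) → x ∈ p ─ q → x ∉ q
x∈p─q⇒x∉q (inside ∷ p) (outside ∷ q) here       ()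
x∈p─q⇒x∉q (_ ∷ p)      (_ ∷ q)       (there x∈) (there x∈q) = x∈p─q⇒x∉q p q x∈ x∈q

weight : Bool → ℕ
weight true  = 1
weight false = 0

module _ (L : Layers N) where
  open Layers L

  block : Bool → Fin (suc k) → Subset N
  block true  i = S i
  block false i = T i ─ S i

  -- The rank is a natural number tied to the index by an equation, so that ranks can be shifted and
  -- compared between lists of different lengths.
  record Placed (x : Fin N) (n : ℕ) (b : Bool) : Set where
    constructor at
    field
      i       : Fin (suc k)
      toℕi≡n  : toℕ i ≡ n
      x∈block : x ∈ block b i

  place : ∀ {i} → x ∈ T i → ∃[ b ] Placed x (toℕ i) b
  place {x = x} {i} x∈T with x ∈? S i
  ... | yes x∈S = true , at i refl x∈S
  ... | no  x∉S = false , at i refl (x∈p∧x∉q⇒x∈p─q x∈T x∉S)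

module Decomposition {G : DAG N} {L : Layers N} (D : IsLayerDecomposition G L) where
  open DAG G
  open Layers L
  open IsLayerDecomposition D

  block⊆T : ∀ b i → block L b i ⊆ T i
  block⊆T true  i = S⊆T i
  block⊆T false i = p─q⊆p (T i) (S i)

  Placed⇒∈V : Placed L x n b → x ∈ V
  Placed⇒∈V {b = b} (at i _ x∈) = T⊆V i (block⊆T b i x∈)

  ∈V⇒Placed : x ∈ V → ∃[ n ] ∃[ b ] Placed L x n b
  ∈V⇒Placed x∈V with i , x∈T ← covers x∈V = toℕ i , place L x∈T

  Placed-unique : Placed L x n b → Placed L x m c → n ≡ m × b ≡ c
  Placed-unique {b = b} {c = c} (at i refl x∈) (at j refl x∈′)
    with refl ← disjoint (block⊆T b i x∈) (block⊆T c j x∈′) = refl , side b c x∈ x∈′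
    where
    side : ∀ b c → _ ∈ block L b i → _ ∈ block L c i → b ≡ c
    side true  true  _  _   = refl
    side false false _  _   = refl
    side true  false p  q   = contradiction p (x∈p─q⇒x∉q (T i) (S i) q)
    side false true  p  q   = contradiction q (x∈p─q⇒x∉q (T i) (S i) p)

  -- This is (D5), split by `view` because the top layer has its own clause.
  parent-of-S : ∀ {i j} → x ∈ T i → y ∈ S j → x ⇒ y → toℕ i ≡ suc (toℕ j)
  parent-of-S {j = j} x∈T y∈S x⇒y with view j
  ... | ‵fromℕ     = contradiction x⇒y (parents-k y∈S)
  ... | ‵inject₁ j with refl ← disjoint x∈T (parents j y∈S x⇒y) = cong suc (sym (toℕ-inject₁ j))

  -- (D4) leaves a child at most two places: R of the same layer or S one layer below. The latter is
  -- excluded for a vertex of R.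
  S-parent-of-R : ∀ {i j} → x ∈ S i → y ∈ T j ─ S j → x ⇒ y → i ≡ j
  S-parent-of-R {i = zero} {j} x∈S y∈R x⇒y =
    disjoint (p─q⊆p _ (S zero) (children-0 x∈S x⇒y)) (p─q⊆p _ (S j) y∈R)
  S-parent-of-R {i = suc i} {j} x∈S y∈R x⇒y
    with x∈p∪q⁻ (T (suc i) ─ S (suc i)) (S (inject₁ i)) (children i x∈S x⇒y)
  ... | inj₁ y∈R′ = disjoint (p─q⊆p _ (S (suc i)) y∈R′) (p─q⊆p _ (S j) y∈R)
  ... | inj₂ y∈S
    with refl ← disjoint (S⊆T (inject₁ i) y∈S) (p─q⊆p _ (S j) y∈R)
    = contradiction y∈S (x∈p─q⇒x∉q (T j) (S j) y∈R)

  -- (D3) speaks only of layers below the top one; above the top there is no layer `j`.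
  R-not-adjacent-above : ∀ {i j} → x ∈ T i ─ S i → y ∈ T j → toℕ i < toℕ j → ¬ Connected x y
  R-not-adjacent-above {i = i} {j} x∈R y∈T i<j with view i
  ... | ‵fromℕ     = contradiction
    (≤-trans i<j (≤-trans (toℕ≤pred[n] j) (≤-reflexive (sym (toℕ-fromℕ _))))) 1+n≰n
  ... | ‵inject₁ i = separated i (inj₂ x∈R) (j , i<j , y∈T)

  parent-of-R : ∀ {i j} → x ∈ T i → y ∈ T j ─ S j → x ⇒ y → i ≡ j
  parent-of-R {x = x} {i = i} {j} x∈T y∈R x⇒y with x ∈? S i
  ... | yes x∈S = S-parent-of-R x∈S y∈R x⇒y
  -- Both ends now lie in R, so (D3) applies from whichever layer is lower; `Connected` ignores the
  -- direction of the arrow.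
  ... | no  x∉S with <-cmp i j
  ...   | tri≈ _ i≡j _ = i≡j
  ...   | tri< i<j _ _ = contradiction (inj₁ x⇒y)
                           (R-not-adjacent-above (x∈p∧x∉q⇒x∈p─q x∈T x∉S) (p─q⊆p _ (S j) y∈R) i<j)
  ...   | tri> _ _ j<i = contradiction (inj₂ x⇒y) (R-not-adjacent-above y∈R x∈T j<i)

  arrow-rank : x ⇒ y → Placed L x n b → Placed L y m c → n ≡ weight c + m
  arrow-rank {b = b} {c = true}  x⇒y (at i refl x∈) (at j refl y∈) =
    parent-of-S (block⊆T b i x∈) y∈ x⇒y
  arrow-rank {b = b} {c = false} x⇒y (at i refl x∈) (at j refl y∈) =
    cong toℕ (parent-of-R (block⊆T b i x∈) y∈ x⇒y)

  -- Drops at intermediate vertices are nonnegative and get discarded; only the drop at the endpoint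
  -- is kept.
  path-rank : TransClosure _⇒_ x y → Placed L x n b → Placed L y m c → weight c + m ≤ n
  path-rank [ x⇒y ] px py = ≤-reflexive (sym (arrow-rank x⇒y px py))
  path-rank (x⇒z ∷ z⇒⁺y) px py with l , d , pz ← ∈V⇒Placed (target x⇒z) =
    ≤-trans (path-rank z⇒⁺y pz py)
      (≤-trans (m≤n+m l (weight d)) (≤-reflexive (sym (arrow-rank x⇒z px pz))))

  bypassed⇒∉S : ∀ {p q} → TransClosure _⇒_ p x → TransClosure _⇒_ x q → Connected p q →
                Placed L x n b → b ≡ false
  -- An arrow from `q` back to `p` would close a cycle through `x`.
  bypassed⇒∉S p⇒⁺x x⇒⁺q (inj₂ q⇒p) _ = contradiction (p⇒⁺x ++ (x⇒⁺q ∷ʳ q⇒p)) acyclic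
  bypassed⇒∉S {b = false} _ _ (inj₁ _) _ = refl
  bypassed⇒∉S {b = true} p⇒⁺x x⇒⁺q (inj₁ p⇒q) px
    with l , d , pp ← ∈V⇒Placed (source p⇒q)
       | r , e , pq ← ∈V⇒Placed (target p⇒q) =
    -- The chain is `1 + n ≤ l ≡ weight e + r ≤ n`: the path to `x`, the arrow, the path from `x`.
    contradiction
      (≤-trans (path-rank p⇒⁺x pp px)
        (≤-trans (≤-reflexive (arrow-rank p⇒q pp pq)) (path-rank x⇒⁺q px pq)))
      1+n≰n

-- The sub-PLD relation at offset zero, in a form whose antisymmetry gives equality of lists.
_⊑_ : Layers N → Layers N → Set
L ⊑ M = ∀ {x n b} → Placed L x n b → Placed M x n b

module _ {G H : DAG N} {L M : Layers N}
         (DL : IsLayerDecomposition G L) (DM : IsLayerDecomposition H M) where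
  private
    module L = Layers L
    module M = Layers M

  -- The top block of `L` is nonempty, and its vertex needs a layer of the same number in `M`.
  ⊑⇒k≤ : L ⊑ M → L.k ≤ M.k
  ⊑⇒k≤ L⊑M
    with x , x∈T ← IsLayerDecomposition.nonempty DL (fromℕ L.k)
    with b , px ← place L x∈T
    with at i i≡ _ ← L⊑M px =
    ≤-trans (≤-reflexive (trans (sym (toℕ-fromℕ L.k)) (sym i≡))) (toℕ≤pred[n] i)

  ⊑⇒block⊆ : L ⊑ M → ∀ b {i j} → toℕ i ≡ toℕ j → block L b i ⊆ block M b j
  ⊑⇒block⊆ L⊑M b {i} {j} i≡j {x} x∈ with at i′ i′≡i x∈′ ← L⊑M (at {b = b} i refl x∈) =
    subst (λ i → x ∈ block M b i) (toℕ-injective (trans i′≡i i≡j)) x∈′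

  ⊑⇒T⊆ : L ⊑ M → ∀ {i j} → toℕ i ≡ toℕ j → L.T i ⊆ M.T j
  ⊑⇒T⊆ L⊑M {i} {j} i≡j x∈T with b , at i′ i′≡i x∈ ← place L x∈T =
    Decomposition.block⊆T DM b j (⊑⇒block⊆ L⊑M b (trans i′≡i i≡j) x∈)

⊑-antisym : {G H : DAG N} {L M : Layers N} →
            IsLayerDecomposition G L → IsLayerDecomposition H M → L ⊑ M → M ⊑ L → L ≡ M
⊑-antisym {L = mkLayers k ps} {mkLayers l qs} DL DM L⊑M M⊑L
  -- Lengths are equated first, since only then do the two vectors share a type.
  with refl ← ≤-antisym (⊑⇒k≤ DL DM L⊑M) (⊑⇒k≤ DM DL M⊑L) =
  cong (mkLayers k) (Pointwise-≡⇒≡ (ext λ i → cong₂ _,_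
    (⊆-antisym (⊑⇒T⊆ DL DM L⊑M refl) (⊑⇒T⊆ DM DL M⊑L refl))
    (⊆-antisym (⊑⇒block⊆ DL DM L⊑M true refl) (⊑⇒block⊆ DM DL M⊑L true refl))))

module _ {G : DAG N} where
  open DAG G

  isDecomposition : (D : PLD G) → IsLayerDecomposition (induced G (PLD.Vars D)) (PLD.layers D)
  isDecomposition D = LayerDecomposition.isLayerDecomposition (PLD.layerDecomposition D)

  subPLD-Placed : (D′ D : PLD G) ((_ , s , _) : IsSubPLD D′ D) →
                  Placed (PLD.layers D′) x n b → Placed (PLD.layers D) x (n + s) b
  subPLD-Placed {b = true}  _ _ (_ , s , sub) (at i refl x∈) with i′ , i′≡ , _ , S⊆ , _ ← sub i =
    at i′ i′≡ (S⊆ x∈)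
  subPLD-Placed {b = false} _ _ (_ , s , sub) (at i refl x∈) with i′ , i′≡ , _ , _ , R⊆ ← sub i =
    at i′ i′≡ (R⊆ x∈)

  -- The rank forced on `x` outside S: an arrow into `x` causes no drop, an arrow into `y` drops by
  -- the weight of `y`.
  neighbourRank : Connected y x → ℕ → Bool → ℕ
  neighbourRank (inj₁ _) n b = n
  neighbourRank (inj₂ _) n b = weight b + n

  x∈Vars : (D D′ : PLD G) → IsInsertion x D D′ → x ∈ PLD.Vars D′
  x∈Vars {x = x} _ _ (_ , Vars≡ , _) = subst (x ∈_) (sym Vars≡) (q⊆p∪q _ _ (x∈⁅x⁆ x))

  insertion-rank : (D D′ : PLD G) ((_ , _ , _ , s , _) : IsInsertion x D D′) →
                   (∀ {n b} → Placed (PLD.layers D′) x n b → b ≡ false) →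
                   Placed (PLD.layers D) y n b → (y~x : Connected y x) →
                   Placed (PLD.layers D′) x (neighbourRank y~x n b + s) false
  insertion-rank {x = x} {n = n} {b = b} D D′ ins@(_ , _ , sub@(Vars⊆ , s , _)) x∉S py y~x
    with m , c , px ← Decomposition.∈V⇒Placed (isDecomposition D′) (x∈Vars D D′ ins)
    with refl ← x∉S px = subst (λ r → Placed (PLD.layers D′) x r false) (rank y~x) px
    where
    open Decomposition (isDecomposition D′)
    x∈ = x∈Vars D D′ ins
    y∈ = Vars⊆ (Decomposition.Placed⇒∈V (isDecomposition D) py)
    py′ = subPLD-Placed D D′ sub py
    rank : ∀ y~x → m ≡ neighbourRank y~x n b + s
    rank (inj₁ y⇒x) = sym (arrow-rank (y∈ , x∈ , y⇒x) py′ px)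
    rank (inj₂ x⇒y) = trans (arrow-rank (x∈ , y∈ , x⇒y) px py′) (sym (+-assoc (weight b) n s))

  -- Only `x` is new, and an old vertex has no placement in `D′` other than its shifted one.
  insertion-Placed⁻ : (D D′ : PLD G) ((_ , _ , _ , s , _) : IsInsertion x D D′) →
                      Placed (PLD.layers D′) y n b →
                      (∃[ m ] (n ≡ m + s × Placed (PLD.layers D) y m b)) ⊎ y ≡ x
  insertion-Placed⁻ {x = x} {y = y} D D′ (_ , Vars≡ , sub) py
    with x∈p∪q⁻ (PLD.Vars D) ⁅ x ⁆
           (subst (y ∈_) Vars≡ (Decomposition.Placed⇒∈V (isDecomposition D′) py))
  ... | inj₂ y∈⁅x⁆ = inj₂ (x∈⁅y⁆⇒x≡y x y∈⁅x⁆)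
  ... | inj₁ y∈D
    with m , c , py′ ← Decomposition.∈V⇒Placed (isDecomposition D) y∈D
    with n≡ , refl ← Decomposition.Placed-unique (isDecomposition D′) py (subPLD-Placed D D′ sub py′)
    = inj₁ (m , n≡ , py′)

  -- The bottom layer of `D′` is nonempty. Its vertex, whether old or `x` itself, has a rank of the
  -- form `m + s` or `r + s`, and this rank is zero.
  insertion-offset≡0 : ∀ {r} (D D′ : PLD G) ((_ , _ , _ , s , _) : IsInsertion x D D′) →
                       Placed (PLD.layers D′) x (r + s) false → s ≡ 0
  insertion-offset≡0 {r = r} D D′ ins px
    with z , z∈T ← IsLayerDecomposition.nonempty (isDecomposition D′) zero
    with b , pz ← place (PLD.layers D′) z∈T
    with insertion-Placed⁻ D D′ ins pz
  ... | inj₁ (m , 0≡m+s , _) = m+n≡0⇒n≡0 m (sym 0≡m+s)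
  ... | inj₂ refl = m+n≡0⇒n≡0 r (proj₁ (Decomposition.Placed-unique (isDecomposition D′) px pz))

  insertion-layers : ∀ {p q} (D D′ : PLD G) → IsInsertion x D D′ → IsExtendable D′ →
    TransClosure _⇒_ p x → TransClosure _⇒_ x q → Connected p q →
    Placed (PLD.layers D) y n b → (y~x : Connected y x) →
    PLD.layers D ⊑ PLD.layers D′ × Placed (PLD.layers D′) x (neighbourRank y~x n b) false
  insertion-layers {x = x} D D′ ins@(_ , _ , sub@(_ , s , _)) (E , sub′) p⇒⁺x x⇒⁺q p~q py y~x
    with px ← insertion-rank D D′ ins
                -- Extendability enters here: `p` and `q` may lie outside `D′`, so the side of `x`
                -- is read off in `E`, which covers all of `G`, and `D′` has the same side.
                (Decomposition.bypassed⇒∉S (LayerDecomposition.isLayerDecomposition E) p⇒⁺x x⇒⁺q p~q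
                  ∘ subPLD-Placed D′ (toPLD E) sub′)
                py y~x
    = (λ {z} {n} {b} pz → shift z n b (subPLD-Placed D D′ sub pz)) , shift x _ false px
    where
    shift : ∀ z n b → Placed (PLD.layers D′) z (n + s) b → Placed (PLD.layers D′) z n b
    shift z n b =
      subst (λ n → Placed (PLD.layers D′) z n b)
        (trans (cong (n +_) (insertion-offset≡0 D D′ ins px)) (+-identityʳ n))

  -- The placements in `D′` are those of `D` together with the one of `x`, so it suffices that `L`
  -- contains these.
  insertion-⊑ : (D D′ : PLD G) {L : Layers _} → IsInsertion x D D′ →
    PLD.layers D ⊑ PLD.layers D′ → Placed (PLD.layers D′) x n b →
    PLD.layers D ⊑ L → Placed L x n b → PLD.layers D′ ⊑ L
  insertion-⊑ D D′ ins D⊑D′ px D⊑L px′ pz with insertion-Placed⁻ D D′ ins pz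
  ... | inj₁ (_ , _ , pz′)
    with refl , refl ← Decomposition.Placed-unique (isDecomposition D′) pz (D⊑D′ pz′) = D⊑L pz′
  ... | inj₂ refl
    with refl , refl ← Decomposition.Placed-unique (isDecomposition D′) pz px = px′

theorem7 : ∀ {N : ℕ} (G : DAG N) (D : PLD G) (X : Fin N) →
    DAG.IsBoundary G (PLD.Vars D) X →
    (∃[ P ] ∃[ Q ] (DAG.ProperAncestor G P X × DAG.ProperDescendant G Q X × DAG.Connected G P Q)) →
    ∀ (D₁ D₂ : PLD G) →
    IsInsertion X D D₁ → IsExtendable D₁ →
    IsInsertion X D D₂ → IsExtendable D₂ →
    PLD.layers D₁ ≡ PLD.layers D₂
theorem7 G D X (_ , Y , Y∈D , Y~X) (P , Q , (_ , P⇒⁺X) , (_ , X⇒⁺Q) , P~Q) D₁ D₂ ins₁ ext₁ ins₂ ext₂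
  with _ , _ , pY ← Decomposition.∈V⇒Placed (isDecomposition D) Y∈D
  -- The same neighbour `Y`, placement and arrow serve both insertions, so `X` gets the identical
  -- rank in each.
  with D⊑D₁ , pX₁ ← insertion-layers D D₁ ins₁ ext₁ P⇒⁺X X⇒⁺Q P~Q pY Y~X
     | D⊑D₂ , pX₂ ← insertion-layers D D₂ ins₂ ext₂ P⇒⁺X X⇒⁺Q P~Q pY Y~X =
  ⊑-antisym (isDecomposition D₁) (isDecomposition D₂)
    (insertion-⊑ D D₁ ins₁ D⊑D₁ pX₁ D⊑D₂ pX₂)
    (insertion-⊑ D D₂ ins₂ D⊑D₂ pX₂ D⊑D₁ pX₁)
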